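{- Let $p$ be a non-negative integer and let $G$ be a connected $\{\text{butterfly},\text{hammer},(K_1\cup K_2)+K_p\}$-free graph with $\omega(G)\neq 2$. Then $$\chi(G)\leq \begin{cases} \omega(G)+\frac{p(p+1)}{2} & \text{if } 1\leq \omega(G)\leq p+1,\\ \omega(G)+\frac{p(p-1)}{2} & \text{if } \omega(G)\geq p+2.\end{cases}$$
   Context: All graphs are simple, finite and undirected. $\omega(G)$ is the clique number and $\chi(G)$ the chromatic number of $G$. For a family $\mathcal{F}$ of graphs, $G$ is $\mathcal{F}$-free if it has no induced subgraph isomorphic to a member of $\mathcal{F}$. The butterfly is the graph on five vertices consisting of two triangles sharing exactly one vertex (with no other edges). The hammer is the graph on five vertices $a,b,c,d,e$ with edges $ab,bc,ac,cd,de$. $K_n$ is the complete graph on $n$ vertices, $K_1\cup K_2$ is the disjoint union of $K_1$ and $K_2$, and for vertex-disjoint graphs $G_1,G_2$ the join $G_1+G_2$ is obtained from their disjoint union by adding all edges between $V(G_1)$ and $V(G_2)$; for $p=0$, $(K_1\cup K_2)+K_p$ is $K_1\cup K_2$. -}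

module Defs where

open import Data.Empty using (⊥; ⊥-elim)
open import Data.Fin.Base using (Fin; splitAt; finToFun; funToFin)
open import Data.Fin.Patterns using (0F; 1F; 2F; 3F; 4F)
open import Data.Fin.Properties using (_≟_; any?; all?; finToFun-funToFin)
open import Data.Fin.Subset as Subset using (Subset; _∈_; ∣_∣)
open import Data.Fin.Subset.Properties using (_∈?_; anySubset?; ∣p∣≤n; ∉⊥; ∣⊥∣≡0)
open import Data.List.Base using (List; []; _∷_)
open import Data.List.Membership.Propositional using () renaming (_∈_ to _∈ᴸ_)
open import Data.List.Membership.DecPropositional using () renaming (_∈?_ to ∈ᴸ-dec)
open import Data.List.Relation.Unary.All using (All)
open import Data.Nat.Base using (ℕ; zero; suc; _+_; _≤_; z≤n; s≤s)
open import Data.Nat.Properties as ℕ using (m≤n⇒m<n∨m≡n)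
open import Data.Product.Base using (∃; ∃-syntax; _×_; _,_; proj₁)
open import Data.Product.Properties using (≡-dec)
open import Data.Sum.Base as Sum using (_⊎_; inj₁; inj₂)
open import Data.Unit.Base using (⊤; tt)
open import Function.Base using (id)
open import Function.Bundles using (_⇔_)
open import Function.Definitions using (Injective)
open import Level using (0ℓ)
open import Relation.Binary.Construct.Closure.ReflexiveTransitive using (Star)
open import Relation.Binary.Core using (Rel)
open import Relation.Binary.Definitions using (Symmetric; Irreflexive; Decidable)
open import Relation.Binary.PropositionalEquality
  using (_≡_; _≢_; refl; sym; subst; subst₂)
open import Relation.Nullary.Decidable using (Dec; yes; no; map′; ¬?; _×-dec_; _⊎-dec_; _→-dec_)
open import Relation.Nullary.Negation using (¬_)
import Relation.Unary as U

-- Adjacency is required to be decidable, as it is classically for every finite graph.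
record Graph : Set₁ where
  field
    order    : ℕ
    Adj      : Rel (Fin order) 0ℓ
    Adj?     : Decidable Adj
    Adj-sym  : Symmetric Adj
    Adj-irr  : Irreflexive _≡_ Adj

  Vertex : Set
  Vertex = Fin order

open Graph public

-- With this definition the graph of order 0 counts as connected.
Connected : Graph → Set
Connected G = ∀ u v → Star (Adj G) u v

InducedIn : Graph → Graph → Set
InducedIn H G = ∃ λ (f : Vertex H → Vertex G) →
  Injective _≡_ _≡_ f × (∀ u v → Adj H u v ⇔ Adj G (f u) (f v))

infix 4 _-Free_

_-Free_ : List Graph → Graph → Set₁
𝓕 -Free G = All (λ H → ¬ InducedIn H G) 𝓕

K : ℕ → Graph
K n = record
  { order    = n
  ; Adj      = _≢_
  ; Adj?     = λ u v → ¬? (u ≟ v)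
  ; Adj-sym  = λ u≢v v≡u → u≢v (sym v≡u)
  ; Adj-irr  = λ u≡v u≢v → u≢v u≡v
  }

-- Edges may be listed in either orientation; loops in the list are ignored.
fromEdges : (n : ℕ) → List (Fin n × Fin n) → Graph
fromEdges n E = record
  { order    = n
  ; Adj      = λ u v → u ≢ v × ((u , v) ∈ᴸ E ⊎ (v , u) ∈ᴸ E)
  ; Adj?     = λ u v → ¬? (u ≟ v) ×-dec ((u , v) ∈E? ⊎-dec (v , u) ∈E?)
  ; Adj-sym  = λ (u≢v , e) → (λ v≡u → u≢v (sym v≡u)) , Sum.swap e
  ; Adj-irr  = λ u≡v (u≢v , _) → u≢v u≡v
  }
  where
  _∈E? : (e : Fin n × Fin n) → Dec (e ∈ᴸ E)
  e ∈E? = ∈ᴸ-dec (≡-dec _≟_ _≟_) e E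

butterfly : Graph
butterfly = fromEdges 5
  ((0F , 1F) ∷ (0F , 2F) ∷ (1F , 2F) ∷ (0F , 3F) ∷ (0F , 4F) ∷ (3F , 4F) ∷ [])

-- The vertices a, b, c, d, e are 0, 1, 2, 3, 4.
hammer : Graph
hammer = fromEdges 5
  ((0F , 1F) ∷ (1F , 2F) ∷ (0F , 2F) ∷ (2F , 3F) ∷ (3F , 4F) ∷ [])

-- Adjacency on V(G) ⊎ V(H), where Cross says whether vertices of G and H are adjacent.
SumAdj : (Cross : Set) (G H : Graph) → Rel (Vertex G ⊎ Vertex H) 0ℓ
SumAdj Cross G H (inj₁ u) (inj₁ v) = Adj G u v
SumAdj Cross G H (inj₂ u) (inj₂ v) = Adj H u v
SumAdj Cross G H (inj₁ _) (inj₂ _) = Cross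
SumAdj Cross G H (inj₂ _) (inj₁ _) = Cross

-- The first order G vertices are those of G, the remaining ones those of H.
sumGraph : (Cross : Set) → Dec Cross → Graph → Graph → Graph
sumGraph Cross cross? G H = record
  { order    = order G + order H
  ; Adj      = λ u v → SumAdj Cross G H (split u) (split v)
  ; Adj?     = λ u v → dec (split u) (split v)
  ; Adj-sym  = λ {u} {v} → symm (split u) (split v)
  ; Adj-irr  = λ { {u} refl → irr (split u) }
  }
  where
  split : Fin (order G + order H) → Vertex G ⊎ Vertex H
  split = splitAt (order G)

  dec : Decidable (SumAdj Cross G H)
  dec (inj₁ u) (inj₁ v) = Adj? G u v
  dec (inj₂ u) (inj₂ v) = Adj? H u v
  dec (inj₁ _) (inj₂ _) = cross?
  dec (inj₂ _) (inj₁ _) = cross?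

  symm : ∀ x y → SumAdj Cross G H x y → SumAdj Cross G H y x
  symm (inj₁ _) (inj₁ _) = Adj-sym G
  symm (inj₂ _) (inj₂ _) = Adj-sym H
  symm (inj₁ _) (inj₂ _) = id
  symm (inj₂ _) (inj₁ _) = id

  irr : ∀ x → ¬ SumAdj Cross G H x x
  irr (inj₁ _) = Adj-irr G refl
  irr (inj₂ _) = Adj-irr H refl

infixl 6 _∪ᴳ_ _+ᴳ_

_∪ᴳ_ : Graph → Graph → Graph
_∪ᴳ_ = sumGraph ⊥ (no λ ())

_+ᴳ_ : Graph → Graph → Graph
_+ᴳ_ = sumGraph ⊤ (yes tt)

IsClique : (G : Graph) → Subset (order G) → Set
IsClique G S = ∀ u v → u ∈ S → v ∈ S → u ≢ v → Adj G u v

HasCliqueOfSize : Graph → ℕ → Set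
HasCliqueOfSize G k = ∃[ S ] IsClique G S × ∣ S ∣ ≡ k

Colourable : Graph → ℕ → Set
Colourable G k = ∃ λ (c : Vertex G → Fin k) → ∀ u v → Adj G u v → c u ≢ c v

IsGreatest IsLeast : U.Pred ℕ 0ℓ → U.Pred ℕ 0ℓ
IsGreatest P m = P m × (∀ k → P k → k ≤ m)
IsLeast    P m = P m × (∀ k → P k → m ≤ k)

greatest : {P : U.Pred ℕ 0ℓ} → U.Decidable P → ∃ P →
           ∀ b → (∀ k → P k → k ≤ b) → ∃ (IsGreatest P)
greatest P? ex b bound with P? b
... | yes Pb = b , Pb , bound
greatest {P} P? (k , Pk) zero    bound | no ¬P0 =
  ⊥-elim (¬P0 (subst P (ℕ.n≤0⇒n≡0 (bound k Pk)) Pk))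
greatest {P} P? ex       (suc b) bound | no ¬Pb = greatest P? ex b bound′
  where
  bound′ : ∀ k → P k → k ≤ b
  bound′ k Pk with m≤n⇒m<n∨m≡n (bound k Pk)
  ... | inj₁ k<1+b = ℕ.≤-pred k<1+b
  ... | inj₂ refl  = ⊥-elim (¬Pb Pk)

least : {P : U.Pred ℕ 0ℓ} → U.Decidable P → ∀ n → P n → ∃ (IsLeast P)
least P? n Pn with P? 0
... | yes P0 = 0 , P0 , λ _ _ → z≤n
least P? zero    Pn | no ¬P0 = ⊥-elim (¬P0 Pn)
least {P} P? (suc n) Pn | no ¬P0 with least {λ k → P (suc k)} (λ k → P? (suc k)) n Pn
... | m , Pm , min = suc m , Pm , λ where
  zero    P0 → ⊥-elim (¬P0 P0)
  (suc k) Pk → s≤s (min k Pk)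

hasCliqueOfSize? : ∀ G → U.Decidable (HasCliqueOfSize G)
hasCliqueOfSize? G k = anySubset? λ S →
  (all? λ u → all? λ v →
    (u ∈? S) →-dec (v ∈? S) →-dec ¬? (u ≟ v) →-dec Adj? G u v)
  ×-dec (∣ S ∣ ℕ.≟ k)

colourable? : ∀ G → U.Decidable (Colourable G)
colourable? G k = map′
  (λ (i , proper) → finToFun i , proper)
  (λ (c , proper) → funToFin c , λ u v e →
    subst₂ _≢_ (sym (finToFun-funToFin c u)) (sym (finToFun-funToFin c v)) (proper u v e))
  (any? λ i → all? λ u → all? λ v →
    Adj? G u v →-dec ¬? (finToFun i u ≟ finToFun i v))

cliqueNumber : ∀ G → ∃ (IsGreatest (HasCliqueOfSize G))
cliqueNumber G = greatest (hasCliqueOfSize? G)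
  (0 , Subset.⊥ , (λ _ _ u∈⊥ → ⊥-elim (∉⊥ u∈⊥)) , ∣⊥∣≡0 (order G))
  (order G) (λ { _ (S , _ , refl) → ∣p∣≤n S })

chromaticNumber : ∀ G → ∃ (IsLeast (Colourable G))
chromaticNumber G = least (colourable? G) (order G)
  (id , λ u v e u≡v → Adj-irr G u≡v e)

ω χ : Graph → ℕ
ω G = proj₁ (cliqueNumber G)
χ G = proj₁ (chromaticNumber G)

{-# OPTIONS --safe #-}
-- The idea is Wagon's colouring of 2K₂-free graphs. In a connected butterfly- and hammer-free
-- graph no edge of a triangle is anticomplete to another edge. Fix a maximum clique a₀, a₁, …
-- and sort the vertices by their non-neighbours in it: those missing only aᵢ form an independent
-- set by maximality, and those whose first two non-neighbours are aᵢ and aⱼ form one because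
-- aᵢaⱼ is an edge of a triangle. Freeness from (K₁ ∪ K₂) + K_p forces j ≤ p, so there are at
-- most p(p+1)/2 classes of the second kind. If ω ≥ p + 2, then the classes with j = p miss every
-- aₖ with k ≥ p, and all of them can share the colour of the vertices missing only a_{p+1}.
module Submission where

open import Defs
open import Data.Bool.Base using (if_then_else_)
open import Data.Empty using (⊥; ⊥-elim)
open import Data.Fin.Base using (Fin; zero; suc; toℕ; fromℕ<; inject≤; punchIn; punchOut)
open import Data.Fin.Patterns using (0F; 1F; 2F)
open import Data.Fin.Properties as Fin
  using (_≟_; _<?_; all?; toℕ-injective; toℕ<n; toℕ-fromℕ<; fromℕ<-injective; toℕ-inject;
         toℕ-inject≤; inject≤-injective; punchIn-injective; punchIn-punchOut; punchInᵢ≢i;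
         suc-injective; ¬∀⟶∃¬-smallest)
open import Data.Fin.Subset using (Subset; _∈_; _∪_; ⁅_⁆; ∣_∣; inside; outside) renaming (⊥ to ∅)
open import Data.Fin.Subset.Properties
  using (∉⊥; x∈⁅x⁆; x∈⁅y⁆⇒x≡y; x∈p∪q⁻; p⊆p∪q; q⊆p∪q; p⊂q⇒∣p∣<∣q∣)
open import Data.List.Base using (List; []; _∷_; allFin; cartesianProduct; filter)
open import Data.List.Membership.Propositional.Properties
  using (∈-filter⁺; ∈-cartesianProduct⁺; ∈-allFin)
open import Data.List.Relation.Unary.All as All using (All; []; _∷_)
open import Data.Nat.Base
  using (ℕ; zero; suc; _+_; _*_; _∸_; _≤_; _≥_; _<_; z≤n; s≤s)
open import Data.Nat.Combinatorics using (_C_; nC1≡n; nCk+nC[k+1]≡[n+1]C[k+1])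
open import Data.Nat.DivMod using (_/_; m*n/n≡m)
open import Data.Nat.Properties as ℕ using (module ≤-Reasoning)
open import Data.Nat.Tactic.RingSolver using (solve-∀)
open import Data.Product.Base using (∃; ∃₂; _×_; _,_; proj₁; proj₂)
open import Data.Sum.Base using (_⊎_; inj₁; inj₂)
open import Data.Unit.Base using (tt)
open import Data.Vec.Base as Vec using ([]; _∷_; here; there)
open import Data.Vec.Functional using (updateAt) renaming (_∷_ to _◂_)
open import Data.Vec.Functional.Properties using (updateAt-updates; updateAt-minimal)
open import Function.Base using (_∘_; const)
open import Function.Bundles using (_⇔_; mk⇔; Equivalence)
open import Function.Definitions using (Injective)
open import Relation.Binary.Construct.Closure.ReflexiveTransitive using (Star; ε; _◅_)
open import Relation.Binary.Definitions using (tri<; tri≈; tri>)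
open import Relation.Binary.PropositionalEquality
  using (_≡_; _≢_; refl; sym; trans; cong; subst; module ≡-Reasoning)
open import Relation.Nullary.Decidable
  using (Dec; yes; no; does; toWitness; _→-dec_; _⊎-dec_)
open import Relation.Nullary.Negation using (¬_; contradiction)
open import Relation.Unary using (Pred; Decidable)
open import Level using (0ℓ)

private
  variable
    m n : ℕ
    A : Set

-- Triangular numbers and a numbering of pairs.

nC2*2 : ∀ n → (n C 2) * 2 ≡ n * (n ∸ 1)
nC2*2 zero            = refl
nC2*2 (suc zero)      = refl
nC2*2 (suc n@(suc k)) = begin
  (suc n C 2) * 2           ≡⟨ cong (_* 2) (nCk+nC[k+1]≡[n+1]C[k+1] n 1) ⟨
  (n C 1 + n C 2) * 2       ≡⟨ cong (λ x → (x + n C 2) * 2) (nC1≡n n) ⟩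
  (n + n C 2) * 2           ≡⟨ ℕ.*-distribʳ-+ 2 n (n C 2) ⟩
  n * 2 + (n C 2) * 2       ≡⟨ cong (n * 2 +_) (nC2*2 n) ⟩
  suc k * 2 + suc k * k     ≡⟨ expand k ⟩
  suc n * n                 ∎
  where
  open ≡-Reasoning
  expand : ∀ k → suc k * 2 + suc k * k ≡ suc (suc k) * suc k
  expand = solve-∀

nC2≡n*[n∸1]/2 : ∀ n → n C 2 ≡ (n * (n ∸ 1)) / 2
nC2≡n*[n∸1]/2 n = trans (sym (m*n/n≡m (n C 2) 2)) (cong (_/ 2) (nC2*2 n))

[1+n]C2≡n+nC2 : ∀ n → suc n C 2 ≡ n + n C 2
[1+n]C2≡n+nC2 n = trans (sym (nCk+nC[k+1]≡[n+1]C[k+1] n 1)) (cong (_+ n C 2) (nC1≡n n))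

C2-mono : m ≤ n → m C 2 ≤ n C 2
C2-mono {m} {n} m≤n = subst (λ x → m C 2 ≤ x C 2) (ℕ.m∸n+n≡m m≤n) (go (n ∸ m))
  where
  go : ∀ d → m C 2 ≤ (d + m) C 2
  go zero    = ℕ.≤-refl
  go (suc d) = ℕ.≤-trans (go d)
    (subst ((d + m) C 2 ≤_) (sym ([1+n]C2≡n+nC2 (d + m))) (ℕ.m≤n+m _ (d + m)))

-- Pairs `i < j` are numbered in blocks of increasing `j`: block `j` starts at `j C 2` and has `j`
-- entries, so the pairs with `j < q` fill exactly the numbers below `q C 2`.
pairCode : ℕ → ℕ → ℕ
pairCode i j = j C 2 + i

pairCode< : ∀ {i j q} → i < j → j < q → pairCode i j < q C 2
pairCode< {i} {j} {q} i<j j<q = begin-strict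
  j C 2 + i    <⟨ ℕ.+-monoʳ-< (j C 2) i<j ⟩
  j C 2 + j    ≡⟨ ℕ.+-comm (j C 2) j ⟩
  j + j C 2    ≡⟨ [1+n]C2≡n+nC2 j ⟨
  suc j C 2    ≤⟨ C2-mono j<q ⟩
  q C 2        ∎
  where open ≤-Reasoning

-- For `j < j′`, the bound `pairCode<` at `q = j′` puts the first code below `j′ C 2`, where block
-- `j′` begins.
pairCode-injective : ∀ {i j i′ j′} → i < j → i′ < j′ →
                     pairCode i j ≡ pairCode i′ j′ → i ≡ i′ × j ≡ j′
pairCode-injective {i} {j} {i′} {j′} i<j i′<j′ eq with ℕ.<-cmp j j′
... | tri< j<j′ _ _ = contradiction eq
  (ℕ.<⇒≢ (ℕ.<-≤-trans (pairCode< i<j j<j′) (ℕ.m≤m+n _ i′)))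
... | tri≈ _ refl _ = ℕ.+-cancelˡ-≡ (j C 2) i i′ eq , refl
... | tri> _ _ j′<j = contradiction (sym eq)
  (ℕ.<⇒≢ (ℕ.<-≤-trans (pairCode< i′<j′ j′<j) (ℕ.m≤m+n _ i)))

-- Finite index sets: searching, updating, enumerating.

firstFailure : {P : Pred (Fin n) 0ℓ} → Decidable P →
               (∀ i → P i) ⊎ (∃ λ i → ¬ P i × (∀ k → toℕ k < toℕ i → P k))
firstFailure {n} {P} P? with all? P?
... | yes all = inj₁ all
... | no ¬all with ¬∀⟶∃¬-smallest n P P? ¬all
...   | i , ¬Pi , below = inj₂ (i , ¬Pi , λ k k<i →
  subst P (toℕ-injective (trans (toℕ-inject (fromℕ< k<i)) (toℕ-fromℕ< k<i))) (below (fromℕ< k<i)))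

-- This is where ω ≠ 2 enters: an edge of the maximum clique becomes an edge of a triangle.
thirdIndex : n ≢ 2 → {i j : Fin n} → i ≢ j → ∃ λ k → k ≢ i × k ≢ j
thirdIndex {1} _   {0F} {0F} i≢j = contradiction refl i≢j
thirdIndex {2} n≢2 _             = contradiction refl n≢2
thirdIndex {suc (suc (suc n))} _ {i} {j} i≢j =
  -- `punchOut` carries `j` to the index set without `i`; `k` is chosen there away from the image of
  -- `j`, and `punchIn i` brings it back.
  punchIn i k , punchInᵢ≢i i k , λ eq →
    punchInᵢ≢i (punchOut i≢j) zero
      (punchIn-injective i _ _ (trans eq (sym (punchIn-punchOut i≢j))))
  where k = punchIn (punchOut i≢j) zero

updateAt-elim : (P : Fin n → A → Set) {a : Fin n → A} {i : Fin n} {x : A} →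
                P i x → (∀ k → k ≢ i → P k (a k)) → ∀ k → P k (updateAt a i (const x) k)
updateAt-elim P {a} {i} new old k with k ≟ i
... | yes refl = subst (P k) (sym (updateAt-updates k a)) new
... | no  k≢i  = subst (P k) (sym (updateAt-minimal k i a k≢i)) (old k k≢i)

enumerate : (S : Subset n) → Fin ∣ S ∣ → Fin n
enumerate (outside ∷ S) i       = suc (enumerate S i)
enumerate (inside  ∷ S) zero    = zero
enumerate (inside  ∷ S) (suc i) = suc (enumerate S i)

enumerate-∈ : (S : Subset n) (i : Fin ∣ S ∣) → enumerate S i ∈ S
enumerate-∈ (outside ∷ S) i       = there (enumerate-∈ S i)
enumerate-∈ (inside  ∷ S) zero    = here
enumerate-∈ (inside  ∷ S) (suc i) = there (enumerate-∈ S i)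

enumerate-injective : (S : Subset n) → Injective _≡_ _≡_ (enumerate S)
enumerate-injective (outside ∷ S) eq = enumerate-injective S (suc-injective eq)
enumerate-injective (inside  ∷ S) {zero}  {zero}  _  = refl
enumerate-injective (inside  ∷ S) {suc i} {suc j} eq =
  cong suc (enumerate-injective S (suc-injective eq))

image : (Fin m → Fin n) → Subset n
image {zero}  f = ∅
image {suc m} f = ⁅ f zero ⁆ ∪ image (f ∘ suc)

∈-image⁻ : (f : Fin m → Fin n) {x : Fin n} → x ∈ image f → ∃ λ i → x ≡ f i
∈-image⁻ {zero}  f x∈ = ⊥-elim (∉⊥ x∈)
∈-image⁻ {suc m} f x∈ with x∈p∪q⁻ ⁅ f zero ⁆ (image (f ∘ suc)) x∈
... | inj₁ x∈₀ = zero , x∈⁅y⁆⇒x≡y (f zero) x∈₀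
... | inj₂ x∈₁ with ∈-image⁻ (f ∘ suc) x∈₁
...   | i , eq = suc i , eq

∣image∣≥ : (f : Fin m → Fin n) → Injective _≡_ _≡_ f → m ≤ ∣ image f ∣
∣image∣≥ {zero}  f inj = z≤n
∣image∣≥ {suc m} f inj = ℕ.≤-<-trans (∣image∣≥ (f ∘ suc) (suc-injective ∘ inj))
  (p⊂q⇒∣p∣<∣q∣ (q⊆p∪q ⁅ f zero ⁆ (image (f ∘ suc)) , f zero , p⊆p∪q _ (x∈⁅x⁆ (f zero)) , f0∉))
  where
  f0∉ : ¬ f zero ∈ image (f ∘ suc)
  f0∉ f0∈ with ∈-image⁻ (f ∘ suc) f0∈
  ... | i , eq with inj eq
  ...   | ()

-- Recognising induced subgraphs.

module _ (H G : Graph) (f : Vertex H → Vertex G) where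

  -- For a concrete `H` this computes to an adjacency or a non-adjacency in `G`, so a copy of `H` is
  -- given by a plain list of edges and non-edges.
  Agree : Vertex H × Vertex H → Set
  Agree (u , v) = if does (Adj? H u v) then Adj G (f u) (f v) else ¬ Adj G (f u) (f v)

  agree⇒⇔ : ∀ u v → Agree (u , v) → Adj H u v ⇔ Adj G (f u) (f v)
  agree⇒⇔ u v agr with Adj? H u v
  ... | yes e  = mk⇔ (const agr) (const e)
  ... | no  ¬e = mk⇔ (⊥-elim ∘ ¬e) (⊥-elim ∘ agr)

TwinFree : Graph → Set
TwinFree H = ∀ u v → (∀ w → Adj H u w → Adj H v w) → (∀ w → Adj H v w → Adj H u w) → u ≡ v

twinFree? : ∀ H → Dec (TwinFree H)
twinFree? H = all? λ u → all? λ v →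
  (all? λ w → Adj? H u w →-dec Adj? H v w) →-dec
  (all? λ w → Adj? H v w →-dec Adj? H u w) →-dec (u ≟ v)

-- Vertices with the same image have the same neighbours in `H`, so twin-freeness makes `f`
-- injective.
twinFree⇒inducedIn : ∀ {H G} → TwinFree H → (f : Vertex H → Vertex G) →
                     (∀ u v → Adj H u v ⇔ Adj G (f u) (f v)) → InducedIn H G
twinFree⇒inducedIn {H} {G} twinFree f f-adj = f , injective , f-adj
  where
  transfer : ∀ {u v} → f u ≡ f v → ∀ w → Adj H u w → Adj H v w
  transfer {u} {v} eq w e = Equivalence.from (f-adj v w)
    (subst (λ x → Adj G x (f w)) eq (Equivalence.to (f-adj u w) e))

  injective : Injective _≡_ _≡_ f
  injective {u} {v} eq = twinFree u v (transfer eq) (transfer (sym eq))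

-- The order is lexicographic; on five vertices it is 01, 02, 03, 04, 12, 13, 14, 23, 24, 34, which
-- the lists of edges and non-edges below follow.
increasingPairs : ∀ n → List (Fin n × Fin n)
increasingPairs n = filter (λ (i , j) → i <? j) (cartesianProduct (allFin n) (allFin n))

agree⇒inducedIn : ∀ {H G} → TwinFree H → (f : Vertex H → Vertex G) →
                  All (Agree H G f) (increasingPairs (order H)) → InducedIn H G
agree⇒inducedIn {H} {G} twinFree f agrees = twinFree⇒inducedIn {H} {G} twinFree f f-adj
  where
  f-adj< : ∀ {u v} → toℕ u < toℕ v → Adj H u v ⇔ Adj G (f u) (f v)
  f-adj< {u} {v} u<v = agree⇒⇔ H G f u v (All.lookup agrees
    (∈-filter⁺ (λ (i , j) → i <? j) (∈-cartesianProduct⁺ (∈-allFin u) (∈-allFin v)) u<v))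

  f-adj : ∀ u v → Adj H u v ⇔ Adj G (f u) (f v)
  f-adj u v with Fin.<-cmp u v
  ... | tri< u<v _ _  = f-adj< u<v
  ... | tri≈ _ refl _ = mk⇔ (⊥-elim ∘ Adj-irr H refl) (⊥-elim ∘ Adj-irr G refl)
  ... | tri> _ _ v<u  = mk⇔
    (Adj-sym G ∘ Equivalence.to (f-adj< v<u) ∘ Adj-sym H)
    (Adj-sym H ∘ Equivalence.from (f-adj< v<u) ∘ Adj-sym G)

butterfly-twinFree : TwinFree butterfly
butterfly-twinFree = toWitness {a? = twinFree? butterfly} tt

hammer-twinFree : TwinFree hammer
hammer-twinFree = toWitness {a? = twinFree? hammer} tt

-- Triangles and distant edges without butterflies and hammers.

module _ (G : Graph) (connected : Connected G)
         (¬butterfly : ¬ InducedIn butterfly G) (¬hammer : ¬ InducedIn hammer G) where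

  private
    infix 4 _~_
    _~_ = Adj G
    ~-sym = Adj-sym G

  module _ {c d} (c~d : c ~ d) where

    Far : Vertex G → Set
    Far x = ¬ x ~ c × ¬ x ~ d

    -- Every new vertex meeting the edge cd completes a butterfly or a hammer.
    far-apex : ∀ {x y z} → x ~ y → z ~ x → z ~ y → Far x → Far y → Far z
    far-apex {x} {y} {z} x~y z~x z~y (x≁c , x≁d) (y≁c , y≁d) with Adj? G z c | Adj? G z d
    ... | no z≁c  | no z≁d  = z≁c , z≁d
    ... | yes z~c | yes z~d = ⊥-elim (¬butterfly (agree⇒inducedIn {butterfly} {G} butterfly-twinFree
      (Vec.lookup (z ∷ x ∷ y ∷ c ∷ d ∷ []))
      (z~x ∷ z~y ∷ z~c ∷ z~d ∷ x~y ∷ x≁c ∷ x≁d ∷ y≁c ∷ y≁d ∷ c~d ∷ [])))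
    ... | yes z~c | no z≁d = ⊥-elim (¬hammer (agree⇒inducedIn {hammer} {G} hammer-twinFree
      (Vec.lookup (x ∷ y ∷ z ∷ c ∷ d ∷ []))
      (x~y ∷ ~-sym z~x ∷ x≁c ∷ x≁d ∷ ~-sym z~y ∷ y≁c ∷ y≁d ∷ z~c ∷ z≁d ∷ c~d ∷ [])))
    ... | no z≁c | yes z~d = ⊥-elim (¬hammer (agree⇒inducedIn {hammer} {G} hammer-twinFree
      (Vec.lookup (x ∷ y ∷ z ∷ d ∷ c ∷ []))
      (x~y ∷ ~-sym z~x ∷ x≁d ∷ x≁c ∷ ~-sym z~y ∷ y≁d ∷ y≁c ∷ z~d ∷ z≁c ∷ ~-sym c~d ∷ [])))

    record FarTriangle (x y z : Vertex G) : Set where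
      field
        x~y   : x ~ y
        y~z   : y ~ z
        x~z   : x ~ z
        far-x : Far x
        far-y : Far y
        far-z : Far z

    rotate : ∀ {x y z} → FarTriangle x y z → FarTriangle y z x
    rotate t = record
      { x~y = y~z ; y~z = ~-sym x~z ; x~z = ~-sym x~y ; far-x = far-y ; far-y = far-z ; far-z = far-x }
      where open FarTriangle t

    swap : ∀ {x y z} → FarTriangle x y z → FarTriangle x z y
    swap t = record
      { x~y = x~z ; y~z = ~-sym y~z ; x~z = x~y ; far-x = far-x ; far-y = far-z ; far-z = far-y }
      where open FarTriangle t

    -- `far-apex` makes `s` far. It is listed first because the walk in `¬farTriangle` always
    -- continues from a neighbour of the first vertex.
    slide : ∀ {s x y z} → FarTriangle x y z → s ~ x → s ~ y → FarTriangle s x y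
    slide t s~x s~y = record
      { x~y = s~x ; y~z = x~y ; x~z = s~y
      ; far-x = far-apex x~y s~x s~y far-x far-y ; far-y = far-x ; far-z = far-y }
      where open FarTriangle t

    -- The far triangle is moved along a walk from its neighbour s to c: since there is no hammer,
    -- either s forms a far triangle with two of its vertices, or the next vertex is adjacent to it.
    ¬farTriangle : ∀ {x y z s} → FarTriangle x y z → s ~ x → Star _~_ s c → ⊥
    ¬farTriangle t s~x ε = proj₁ (FarTriangle.far-x t) (~-sym s~x)
    ¬farTriangle {x} {y} {z} {s} t s~x (_◅_ {j = r} s~r walk)
      with Adj? G s y | Adj? G s z | Adj? G r x | Adj? G r y | Adj? G r z
    ... | yes s~y | _ | _ | _ | _ = ¬farTriangle (slide t s~x s~y) (~-sym s~r) walk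
    ... | _ | yes s~z | _ | _ | _ = ¬farTriangle (slide (swap t) s~x s~z) (~-sym s~r) walk
    ... | _ | _ | yes r~x | _ | _ = ¬farTriangle t r~x walk
    ... | _ | _ | _ | yes r~y | _ = ¬farTriangle (rotate t) r~y walk
    ... | _ | _ | _ | _ | yes r~z = ¬farTriangle (rotate (rotate t)) r~z walk
    ... | no s≁y | no s≁z | no r≁x | no r≁y | no r≁z =
      ¬hammer (agree⇒inducedIn {hammer} {G} hammer-twinFree
        (Vec.lookup (y ∷ z ∷ x ∷ s ∷ r ∷ []))
        (y~z ∷ ~-sym x~y ∷ s≁y ∘ ~-sym ∷ r≁y ∘ ~-sym ∷ ~-sym x~z ∷ s≁z ∘ ~-sym ∷ r≁z ∘ ~-sym ∷
         ~-sym s~x ∷ r≁x ∘ ~-sym ∷ s~r ∷ []))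
      where open FarTriangle t

  -- Otherwise `far-apex` makes `z` far from `c` and `d` too, and connectivity supplies a walk to
  -- `c` from `y`, a neighbour of `x`, which `¬farTriangle` excludes.
  triangle-dominates : ∀ {x y z c d} → x ~ y → z ~ x → z ~ y → c ~ d →
    ¬ x ~ c → ¬ x ~ d → ¬ y ~ c → ¬ y ~ d → ⊥
  triangle-dominates {x} {y} {z} {c} x~y z~x z~y c~d x≁c x≁d y≁c y≁d =
    ¬farTriangle c~d
      (record { x~y = x~y ; y~z = ~-sym z~y ; x~z = ~-sym z~x ; far-x = x≁c , x≁d ; far-y = y≁c , y≁d
              ; far-z = far-apex c~d x~y z~x z~y (x≁c , x≁d) (y≁c , y≁d) })
      (~-sym x~y) (connected y c)

-- Colouring by independent classes.

Independent : (G : Graph) → Pred (Vertex G) 0ℓ → Set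
Independent G S = ∀ {u v} → S u → S v → ¬ Adj G u v

-- The classes `S i` receive the first `m` colours and `T i j` the colour `m + pairCode i j`.
-- Classes may overlap, since a vertex takes the colour of the class chosen for it.
colourable-byClasses : (G : Graph) (q : ℕ) (S : Fin m → Pred (Vertex G) 0ℓ)
  (T : ℕ → ℕ → Pred (Vertex G) 0ℓ) →
  (∀ i → Independent G (S i)) → (∀ i j → Independent G (T i j)) →
  (∀ v → (∃ λ i → S i v) ⊎ (∃₂ λ i j → T i j v × i < j × j < q)) →
  Colourable G (m + q C 2)
colourable-byClasses {m} G q S T S-ind T-ind classify =
  (λ v → fromℕ< (code< (classify v))) ,
  λ u v u~v eq → code-proper (classify u) (classify v) u~v
    (fromℕ<-injective _ _ (code< (classify u)) (code< (classify v)) eq)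
  where
  Class : Vertex G → Set
  Class v = (∃ λ i → S i v) ⊎ (∃₂ λ i j → T i j v × i < j × j < q)

  code : ∀ {v} → Class v → ℕ
  code (inj₁ (i , _))     = toℕ i
  code (inj₂ (i , j , _)) = m + pairCode i j

  code< : ∀ {v} (c : Class v) → code c < m + q C 2
  code< (inj₁ (i , _))                 = ℕ.<-≤-trans (toℕ<n i) (ℕ.m≤m+n m _)
  code< (inj₂ (_ , _ , _ , i<j , j<q)) = ℕ.+-monoʳ-< m (pairCode< i<j j<q)

  toℕ≢m+ : ∀ (i : Fin m) k → toℕ i ≢ m + k
  toℕ≢m+ i k = ℕ.<⇒≢ (ℕ.<-≤-trans (toℕ<n i) (ℕ.m≤m+n m k))

  code-proper : ∀ {u v} (c : Class u) (d : Class v) → Adj G u v → code c ≢ code d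
  code-proper (inj₁ (i , Su)) (inj₁ (j , Sv)) u~v eq with toℕ-injective eq
  ... | refl = S-ind i Su Sv u~v
  code-proper (inj₁ (i , _)) (inj₂ _) _ eq = toℕ≢m+ i _ eq
  code-proper (inj₂ _) (inj₁ (i , _)) _ eq = toℕ≢m+ i _ (sym eq)
  code-proper (inj₂ (i , j , Tu , i<j , _)) (inj₂ (i′ , j′ , Tv , i′<j′ , _)) u~v eq
    with pairCode-injective i<j i′<j′ (ℕ.+-cancelˡ-≡ m _ _ eq)
  ... | refl , refl = T-ind i j Tu Tv u~v

-- Cliques as indexed families.

module _ (G : Graph) where

  -- Indexing orders the clique, so that first non-neighbours make sense, and lets a single vertex
  -- be exchanged.
  CliqueMap : (Fin n → Vertex G) → Set
  CliqueMap a = ∀ i j → i ≢ j → Adj G (a i) (a j)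

  cliqueMap-injective : {a : Fin n → Vertex G} → CliqueMap a → Injective _≡_ _≡_ a
  cliqueMap-injective a-clique {i} {j} eq with i ≟ j
  ... | yes i≡j = i≡j
  ... | no  i≢j = contradiction (a-clique i j i≢j) (Adj-irr G eq)

  hasClique⇒cliqueMap : HasCliqueOfSize G n → ∃ λ (a : Fin n → Vertex G) → CliqueMap a
  hasClique⇒cliqueMap (S , S-clique , refl) = enumerate S , λ i j i≢j →
    S-clique _ _ (enumerate-∈ S i) (enumerate-∈ S j) (i≢j ∘ enumerate-injective S)

  cliqueMap⇒hasClique : {a : Fin n → Vertex G} → CliqueMap a → ∃ λ k → HasCliqueOfSize G k × n ≤ k
  cliqueMap⇒hasClique {a = a} a-clique =
    ∣ image a ∣ , (image a , image-clique , refl) , ∣image∣≥ a (cliqueMap-injective a-clique)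
    where
    image-clique : IsClique G (image a)
    image-clique u v u∈ v∈ u≢v with ∈-image⁻ a u∈ | ∈-image⁻ a v∈
    ... | i , refl | j , refl = a-clique i j (u≢v ∘ cong a)

  extend-cliqueMap : {a : Fin n → Vertex G} {v : Vertex G} → CliqueMap a →
                     (∀ k → Adj G v (a k)) → CliqueMap (v ◂ a)
  extend-cliqueMap a-clique v~a zero    zero    i≢j = contradiction refl i≢j
  extend-cliqueMap a-clique v~a zero    (suc j) _   = v~a j
  extend-cliqueMap a-clique v~a (suc i) zero    _   = Adj-sym G (v~a i)
  extend-cliqueMap a-clique v~a (suc i) (suc j) i≢j = a-clique i j (i≢j ∘ cong suc)

  -- The outer `updateAt-elim` asks whether the first endpoint is the new vertex, the inner ones ask
  -- this of the second.
  updateAt-cliqueMap : {a : Fin n → Vertex G} {i : Fin n} {v : Vertex G} → CliqueMap a →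
                       (∀ k → k ≢ i → Adj G v (a k)) → CliqueMap (updateAt a i (const v))
  updateAt-cliqueMap {a = a} a-clique v~a = updateAt-elim
    (λ k x → ∀ l → k ≢ l → Adj G x (updateAt a _ (const _) l))
    (updateAt-elim (λ l y → _ ≢ l → Adj G _ y) (contradiction refl) λ l l≢i _ → v~a l l≢i)
    (λ k k≢i → updateAt-elim (λ l y → k ≢ l → Adj G (a k) y)
      (λ _ → Adj-sym G (v~a k k≢i)) λ l _ → a-clique k l)

  -- Neighbours in a clique under freeness from (K₁ ∪ K₂) + K_p.

  module _ {p} (¬Kp : ¬ InducedIn ((K 1 ∪ᴳ K 2) +ᴳ K p) G) where

    -- Here `v` plays K₁, the edge aᵢaⱼ plays K₂ and the vertices `a (g k)` play K_p; these avoid aᵢ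
    -- and aⱼ because `v` is adjacent to them.
    atMost-p-1-neighbours : {a : Fin n → Vertex G} → CliqueMap a →
      ∀ {v i j} → i ≢ j → ¬ Adj G v (a i) → ¬ Adj G v (a j) →
      (g : Fin p → Fin n) → Injective _≡_ _≡_ g → ¬ (∀ k → Adj G v (a (g k)))
    atMost-p-1-neighbours {a = a} a-clique {v} {i} {j} i≢j v≁aᵢ v≁aⱼ g g-inj v~ag =
      ¬Kp (twinFree⇒inducedIn {H} {G} twinFree f f-adj)
      where
      H : Graph
      H = (K 1 ∪ᴳ K 2) +ᴳ K p

      f : Vertex H → Vertex G
      f 0F                  = v
      f 1F                  = a i
      f 2F                  = a j
      f (suc (suc (suc k))) = a (g k)

      g≢ : ∀ {l} → ¬ Adj G v (a l) → ∀ k → g k ≢ l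
      g≢ v≁aₗ k refl = v≁aₗ (v~ag k)

      both : {X Y : Set} → X → Y → X ⇔ Y
      both x y = mk⇔ (const y) (const x)

      neither : {X Y : Set} → ¬ X → ¬ Y → X ⇔ Y
      neither ¬x ¬y = mk⇔ (⊥-elim ∘ ¬x) (⊥-elim ∘ ¬y)

      f-adj : ∀ u w → Adj H u w ⇔ Adj G (f u) (f w)
      f-adj 0F 0F = neither (λ 0≢0 → 0≢0 refl) (Adj-irr G refl)
      f-adj 0F 1F = neither (λ ()) v≁aᵢ
      f-adj 0F 2F = neither (λ ()) v≁aⱼ
      f-adj 0F (suc (suc (suc k))) = both tt (v~ag k)
      f-adj 1F 0F = neither (λ ()) (v≁aᵢ ∘ Adj-sym G)
      f-adj 1F 1F = neither (λ 0≢0 → 0≢0 refl) (Adj-irr G refl)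
      f-adj 1F 2F = both (λ ()) (a-clique i j i≢j)
      f-adj 1F (suc (suc (suc k))) = both tt (a-clique i (g k) (g≢ v≁aᵢ k ∘ sym))
      f-adj 2F 0F = neither (λ ()) (v≁aⱼ ∘ Adj-sym G)
      f-adj 2F 1F = both (λ ()) (a-clique j i (i≢j ∘ sym))
      f-adj 2F 2F = neither (λ 1≢1 → 1≢1 refl) (Adj-irr G refl)
      f-adj 2F (suc (suc (suc k))) = both tt (a-clique j (g k) (g≢ v≁aⱼ k ∘ sym))
      f-adj (suc (suc (suc k))) 0F = both tt (Adj-sym G (v~ag k))
      f-adj (suc (suc (suc k))) 1F = both tt (a-clique (g k) i (g≢ v≁aᵢ k))
      f-adj (suc (suc (suc k))) 2F = both tt (a-clique (g k) j (g≢ v≁aⱼ k))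
      f-adj (suc (suc (suc k))) (suc (suc (suc l))) = mk⇔
        (λ k≢l → a-clique (g k) (g l) (k≢l ∘ g-inj))
        (λ e k≡l → Adj-irr G (cong (a ∘ g) k≡l) e)

      -- Adjacent vertices are told apart by one of themselves, as there are no loops. The only
      -- distinct non-adjacent pairs join `0F` to `1F` or `2F`, and the other end of the K₂ tells
      -- them apart.
      twinFree : TwinFree H
      twinFree 0F 0F _ _ = refl
      twinFree 0F 1F _ ⊇ = ⊥-elim (⊇ 2F λ ())
      twinFree 0F 2F _ ⊇ = ⊥-elim (⊇ 1F λ ())
      twinFree 0F (suc (suc (suc k))) _ ⊇ = ⊥-elim (⊇ 0F tt refl)
      twinFree 1F 0F ⊆ _ = ⊥-elim (⊆ 2F λ ())
      twinFree 1F 1F _ _ = refl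
      twinFree 1F 2F ⊆ _ = ⊥-elim (⊆ 2F (λ ()) refl)
      twinFree 1F (suc (suc (suc k))) _ ⊇ = ⊥-elim (⊇ 1F tt refl)
      twinFree 2F 0F ⊆ _ = ⊥-elim (⊆ 1F λ ())
      twinFree 2F 1F _ ⊇ = ⊥-elim (⊇ 2F (λ ()) refl)
      twinFree 2F 2F _ _ = refl
      twinFree 2F (suc (suc (suc k))) _ ⊇ = ⊥-elim (⊇ 2F tt refl)
      twinFree (suc (suc (suc k))) 0F ⊆ _ = ⊥-elim (⊆ 0F tt refl)
      twinFree (suc (suc (suc k))) 1F ⊆ _ = ⊥-elim (⊆ 1F tt refl)
      twinFree (suc (suc (suc k))) 2F ⊆ _ = ⊥-elim (⊆ 2F tt refl)
      twinFree (suc (suc (suc k))) (suc (suc (suc l))) ⊆ _ with k ≟ l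
      ... | yes refl = refl
      ... | no  k≢l  = ⊥-elim (⊆ (suc (suc (suc l))) k≢l refl)

    -- p neighbours in the clique: the first p vertices, with aₗ in place of aᵢ if i < p.
    ¬nearlyComplete : {a : Fin n → Vertex G} → CliqueMap a →
      ∀ {v i j} → i ≢ j → ¬ Adj G v (a i) → ¬ Adj G v (a j) →
      ∀ l → p ≤ toℕ l → (toℕ i < p → Adj G v (a l)) →
      ¬ (∀ k → toℕ k < p → k ≢ i → Adj G v (a k))
    ¬nearlyComplete {n} {a} a-clique {v} {i} i≢j v≁aᵢ v≁aⱼ l p≤l v~aₗ v~a =
      atMost-p-1-neighbours a-clique i≢j v≁aᵢ v≁aⱼ g (λ {s} {t} → g-injective s t) v~ag
      where
      p≤n : p ≤ n
      p≤n = ℕ.≤-trans p≤l (ℕ.<⇒≤ (toℕ<n l))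

      initial : Fin p → Fin n
      initial k = inject≤ k p≤n

      initial<p : ∀ k → toℕ (initial k) < p
      initial<p k = subst (_< p) (sym (toℕ-inject≤ k p≤n)) (toℕ<n k)

      initial≢l : ∀ k → initial k ≢ l
      initial≢l k eq = ℕ.<⇒≱ (initial<p k) (subst (λ x → p ≤ toℕ x) (sym eq) p≤l)

      g : Fin p → Fin n
      g k with initial k ≟ i
      ... | yes _ = l
      ... | no  _ = initial k

      g-injective : ∀ s t → g s ≡ g t → s ≡ t
      g-injective s t eq with initial s ≟ i | initial t ≟ i
      ... | yes s≡i | yes t≡i = inject≤-injective p≤n p≤n s t (trans s≡i (sym t≡i))
      ... | yes _   | no  _   = contradiction (sym eq) (initial≢l t)
      ... | no  _   | yes _   = contradiction eq (initial≢l s)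
      ... | no  _   | no  _   = inject≤-injective p≤n p≤n s t eq

      v~ag : ∀ k → Adj G v (a (g k))
      v~ag k with initial k ≟ i
      ... | yes k≡i = v~aₗ (subst (λ x → toℕ x < p) k≡i (initial<p k))
      ... | no  k≢i = v~a (initial k) (initial<p k) k≢i

-- Classes of non-neighbours of a maximum clique.

module _ (G : Graph) (connected : Connected G)
         (¬butterfly : ¬ InducedIn butterfly G) (¬hammer : ¬ InducedIn hammer G)
         {p} (¬Kp : ¬ InducedIn ((K 1 ∪ᴳ K 2) +ᴳ K p) G)
         {n} (n≢2 : n ≢ 2) {a : Fin n → Vertex G} (a-clique : CliqueMap G a)
         (a-maximum : {b : Fin (suc n) → Vertex G} → ¬ CliqueMap G b) where

  private
    infix 4 _~_
    _~_ = Adj G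

  MissesOnly : Fin n → Pred (Vertex G) 0ℓ
  MissesOnly i v = ¬ v ~ a i × (∀ k → k ≢ i → v ~ a k)

  MissesFirst : Fin n → Fin n → Pred (Vertex G) 0ℓ
  MissesFirst i j v =
    ¬ v ~ a i × ¬ v ~ a j × toℕ i < toℕ j × (∀ k → toℕ k < toℕ j → k ≢ i → v ~ a k)

  -- A vertex adjacent to the whole clique would enlarge it, so some aᵢ is missed; a member of the
  -- clique misses itself.
  misses : ∀ v → (∃ λ i → MissesOnly i v) ⊎ (∃₂ λ i j → MissesFirst i j v)
  misses v with firstFailure (λ k → Adj? G v (a k))
  ... | inj₁ v~a = ⊥-elim (a-maximum (extend-cliqueMap G a-clique v~a))
  -- Allowing `k ≡ i` makes the second search skip `i`, so that its first failure is the second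
  -- non-neighbour.
  ... | inj₂ (i , v≁aᵢ , below-i) with firstFailure (λ k → (k ≟ i) ⊎-dec Adj? G v (a k))
  ...   | inj₁ rest = inj₁ (i , v≁aᵢ , λ k k≢i → unless k≢i (rest k))
    where
    unless : ∀ {k} → k ≢ i → k ≡ i ⊎ v ~ a k → v ~ a k
    unless k≢i (inj₁ k≡i) = contradiction k≡i k≢i
    unless _   (inj₂ e)   = e
  ...   | inj₂ (j , ¬j , below-j) = inj₂ (i , j , v≁aᵢ , ¬j ∘ inj₂ , i<j , below)
    where
    i<j : toℕ i < toℕ j
    i<j with Fin.<-cmp i j
    ... | tri< i<j _ _  = i<j
    ... | tri≈ _ refl _ = contradiction (inj₁ refl) ¬j
    ... | tri> _ _ j<i  = contradiction (inj₂ (below-i j j<i)) ¬j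

    below : ∀ k → toℕ k < toℕ j → k ≢ i → v ~ a k
    below k k<j k≢i with below-j k k<j
    ... | inj₁ k≡i = contradiction k≡i k≢i
    ... | inj₂ e   = e

  -- An edge between two such vertices would be anticomplete to aᵢaⱼ, which lies in a triangle.
  commonNonneighbours-independent : ∀ {i j} → i ≢ j →
    Independent G (λ v → ¬ v ~ a i × ¬ v ~ a j)
  commonNonneighbours-independent {i} {j} i≢j (u≁aᵢ , u≁aⱼ) (w≁aᵢ , w≁aⱼ) u~w
    with thirdIndex n≢2 i≢j
  ... | k , k≢i , k≢j = triangle-dominates G connected ¬butterfly ¬hammer
    (a-clique i j i≢j) (a-clique k i k≢i) (a-clique k j k≢j) u~w
    (u≁aᵢ ∘ Adj-sym G) (w≁aᵢ ∘ Adj-sym G) (u≁aⱼ ∘ Adj-sym G) (w≁aⱼ ∘ Adj-sym G)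

  -- If `u ~ w`, exchanging aᵢ for `w` keeps a clique, and `u` is adjacent to all of it: a clique on
  -- `suc n` vertices.
  missesOnly-independent : ∀ i → Independent G (MissesOnly i)
  missesOnly-independent i (_ , u~a) (_ , w~a) u~w =
    a-maximum (extend-cliqueMap G (updateAt-cliqueMap G a-clique w~a)
      (updateAt-elim (λ _ → _ ~_) u~w u~a))

  -- For p < j, `v` is adjacent to every one of a₀, ..., a_p except possibly aᵢ, hence to at least p
  -- vertices of the clique.
  missesFirst≤p : ∀ {i j v} → MissesFirst i j v → toℕ j ≤ p
  missesFirst≤p {i} {j} {v} (v≁aᵢ , v≁aⱼ , i<j , v~a) = ℕ.≮⇒≥ λ p<j →
    -- The index p replaces `i` when i < p; it lies below `j` and differs from `i`, so `v` is
    -- adjacent to its vertex.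
    let p<n = ℕ.<-trans p<j (toℕ<n j)
        l   = fromℕ< p<n
        l≡p = toℕ-fromℕ< p<n
    in ¬nearlyComplete G ¬Kp a-clique (λ i≡j → ℕ.<⇒≢ i<j (cong toℕ i≡j)) v≁aᵢ v≁aⱼ
         l (ℕ.≤-reflexive (sym l≡p))
         (λ i<p → v~a l (subst (_< toℕ j) (sym l≡p) p<j)
           λ l≡i → ℕ.<⇒≢ i<p (trans (cong toℕ (sym l≡i)) l≡p))
         (λ k k<p → v~a k (ℕ.<-trans k<p p<j))

  -- Numerical indices match the classes `T` of `colourable-byClasses` and the arguments of
  -- `pairCode`.
  MissesFirstℕ : ℕ → ℕ → Pred (Vertex G) 0ℓ
  MissesFirstℕ i j v = ∃₂ λ x y → MissesFirst x y v × toℕ x ≡ i × toℕ y ≡ j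

  missesFirstℕ-independent : ∀ i j → Independent G (MissesFirstℕ i j)
  missesFirstℕ-independent i j (x , y , (u≁x , u≁y , x<y , _) , refl , refl)
                               (x′ , y′ , (w≁x , w≁y , _) , x′≡x , y′≡y)
    with toℕ-injective x′≡x | toℕ-injective y′≡y
  ... | refl | refl = commonNonneighbours-independent
    (λ x≡y → ℕ.<⇒≢ x<y (cong toℕ x≡y)) (u≁x , u≁y) (w≁x , w≁y)

  colourable-n+[1+p]C2 : Colourable G (n + suc p C 2)
  colourable-n+[1+p]C2 = colourable-byClasses G (suc p) MissesOnly MissesFirstℕ
    missesOnly-independent missesFirstℕ-independent classify
    where
    classify : ∀ v → (∃ λ i → MissesOnly i v) ⊎ (∃₂ λ i j → MissesFirstℕ i j v × i < j × j < suc p)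
    classify v with misses v
    ... | inj₁ only = inj₁ only
    ... | inj₂ (i , j , first@(_ , _ , i<j , _)) =
      inj₂ (toℕ i , toℕ j , (i , j , first , refl , refl) , i<j , s≤s (missesFirst≤p first))

  -- Saving p colours for cliques of size at least p + 2.

  module _ (2+p≤n : 2 + p ≤ n) where

    -- `2 + p ≤ n` unfolds to `suc p < n`, so this is the index p + 1.
    ℓ : Fin n
    ℓ = fromℕ< 2+p≤n

    ℓ≡1+p : toℕ ℓ ≡ suc p
    ℓ≡1+p = toℕ-fromℕ< 2+p≤n

    p≤ℓ : p ≤ toℕ ℓ
    p≤ℓ = subst (p ≤_) (sym ℓ≡1+p) (ℕ.n≤1+n p)

    -- The union of the classes with second index p, one for each i < p; their p colours are the
    -- difference between `suc p C 2` and `p C 2`.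
    MissesFrom-p : Pred (Vertex G) 0ℓ
    MissesFrom-p v = ∃₂ λ i j → MissesFirst i j v × toℕ j ≡ p

    j≢ℓ : ∀ {j} → toℕ j ≡ p → j ≢ ℓ
    j≢ℓ j≡p refl = ℕ.1+n≢n (trans (sym ℓ≡1+p) j≡p)

    -- Such a vertex already has p - 1 neighbours among a₀, ..., a_{p-1}, all but aᵢ; the vertex at
    -- `ℓ` would be the p-th.
    missesFrom-p-misses-ℓ : ∀ {v} → MissesFrom-p v → ¬ v ~ a ℓ
    missesFrom-p-misses-ℓ (i , j , (v≁aᵢ , v≁aⱼ , i<j , v~a) , refl) v~ℓ =
      ¬nearlyComplete G ¬Kp a-clique (λ i≡j → ℕ.<⇒≢ i<j (cong toℕ i≡j)) v≁aᵢ v≁aⱼ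
        ℓ p≤ℓ (const v~ℓ) v~a

    -- All these vertices miss both a_p and the vertex at `ℓ`, so one clique edge serves every `i`
    -- at once.
    missesFrom-p-independent : Independent G MissesFrom-p
    missesFrom-p-independent Mu@(_ , j , (_ , u≁aⱼ , _) , j≡p) Mw@(_ , j′ , (_ , w≁aⱼ , _) , j′≡p)
      with toℕ-injective (trans j≡p (sym j′≡p))
    ... | refl = commonNonneighbours-independent (j≢ℓ j≡p)
      (u≁aⱼ , missesFrom-p-misses-ℓ Mu) (w≁aⱼ , missesFrom-p-misses-ℓ Mw)

    -- An edge would give u too many neighbours in the maximum clique where w replaces a_{p+1}.
    missesFrom-p-missesOnly : ∀ {u w} → MissesFrom-p u → MissesOnly ℓ w → ¬ u ~ w
    missesFrom-p-missesOnly {u} {w} (i , j , (u≁aᵢ , u≁aⱼ , i<j , u~a) , refl) (_ , w~a) u~w =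
      ¬nearlyComplete G ¬Kp (updateAt-cliqueMap G a-clique w~a)
        (λ i≡j → ℕ.<⇒≢ i<j (cong toℕ i≡j)) (retained i≢ℓ u≁aᵢ) (retained (j≢ℓ refl) u≁aⱼ)
        ℓ p≤ℓ (λ _ → subst (u ~_) (sym (updateAt-updates ℓ a)) u~w)
        (updateAt-elim (λ k x → toℕ k < toℕ j → k ≢ i → u ~ x)
          (λ _ _ → u~w) (λ k _ → u~a k))
      where
      i≢ℓ : i ≢ ℓ
      i≢ℓ refl = ℕ.<⇒≱ i<j p≤ℓ

      retained : ∀ {k} → k ≢ ℓ → ¬ u ~ a k → ¬ u ~ updateAt a ℓ (const w) k
      retained {k} k≢ℓ = subst (λ x → ¬ u ~ x) (sym (updateAt-minimal k ℓ a k≢ℓ))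

    Merged : Fin n → Pred (Vertex G) 0ℓ
    Merged i v = MissesOnly i v ⊎ (i ≡ ℓ × MissesFrom-p v)

    merged-independent : ∀ i → Independent G (Merged i)
    merged-independent i (inj₁ Ou)          (inj₁ Ow)          = missesOnly-independent i Ou Ow
    merged-independent i (inj₁ Ou)          (inj₂ (refl , Mw)) =
      missesFrom-p-missesOnly Mw Ou ∘ Adj-sym G
    merged-independent i (inj₂ (refl , Mu)) (inj₁ Ow)          = missesFrom-p-missesOnly Mu Ow
    merged-independent i (inj₂ (_ , Mu))    (inj₂ (_ , Mw))    = missesFrom-p-independent Mu Mw

    colourable-n+pC2 : Colourable G (n + p C 2)
    colourable-n+pC2 = colourable-byClasses G p Merged MissesFirstℕ
      merged-independent missesFirstℕ-independent classify
      where
      classify : ∀ v → (∃ λ i → Merged i v) ⊎ (∃₂ λ i j → MissesFirstℕ i j v × i < j × j < p)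
      classify v with misses v
      ... | inj₁ (i , only) = inj₁ (i , inj₁ only)
      ... | inj₂ (i , j , first@(_ , _ , i<j , _)) with ℕ.m≤n⇒m<n∨m≡n (missesFirst≤p first)
      ...   | inj₁ j<p = inj₂ (toℕ i , toℕ j , (i , j , first , refl , refl) , i<j , j<p)
      ...   | inj₂ j≡p = inj₁ (ℓ , inj₂ (refl , i , j , first , j≡p))

-- From the colourings to the bounds on the chromatic number.

χ≤ : ∀ {G k} → Colourable G k → χ G ≤ k
χ≤ {G} {k} = proj₂ (proj₂ (chromaticNumber G)) k

theorem3p19 : (p : ℕ) (G : Graph) → Connected G →
    (butterfly ∷ hammer ∷ (K 1 ∪ᴳ K 2) +ᴳ K p ∷ []) -Free G →
    ω G ≢ 2 →
    (1 ≤ ω G × ω G ≤ p + 1 → χ G ≤ ω G + (p * (p + 1)) / 2) ×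
    (ω G ≥ p + 2 → χ G ≤ ω G + (p * (p ∸ 1)) / 2)
theorem3p19 p G connected (¬butterfly ∷ ¬hammer ∷ ¬Kp ∷ []) ω≢2 with cliqueNumber G
... | n , hasClique , greatest with hasClique⇒cliqueMap G hasClique
...   | a , a-clique =
  (λ _ → subst (λ x → χ G ≤ n + x) [1+p]C2≡ (χ≤ {G} colourable₁)) ,
  (λ n≥p+2 → subst (λ x → χ G ≤ n + x) (nC2≡n*[n∸1]/2 p)
    (χ≤ {G} (colourable₂ (subst (_≤ n) (ℕ.+-comm p 2) n≥p+2))))
  where
  a-maximum : {b : Fin (suc n) → Vertex G} → ¬ CliqueMap G b
  a-maximum b-clique with cliqueMap⇒hasClique G b-clique
  ... | k , hasCliqueₖ , n<k = ℕ.<⇒≱ n<k (greatest k hasCliqueₖ)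

  colourable₁ = colourable-n+[1+p]C2 G connected ¬butterfly ¬hammer ¬Kp ω≢2 a-clique a-maximum
  colourable₂ = colourable-n+pC2 G connected ¬butterfly ¬hammer ¬Kp ω≢2 a-clique a-maximum

  [1+p]C2≡ : suc p C 2 ≡ (p * (p + 1)) / 2
  [1+p]C2≡ = trans (nC2≡n*[n∸1]/2 (suc p))
    (cong (_/ 2) (trans (ℕ.*-comm (suc p) p) (cong (p *_) (ℕ.+-comm 1 p))))
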